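{- Let $r\ge 1$ and let $\mathcal{H}$ be an $r$-graph on $n$ vertices with $e$ edges. Then $$i_1(\mathcal{H})\le i_1(\mathcal{C}_r(n,e)).$$
   Context: $[n]=\{0,1,\dots,n-1\}$. An $r$-graph is an $r$-uniform hypergraph. A set $I$ of vertices is $1$-independent in $\mathcal{H}$ if $|I\cap E|<1$ for every edge $E$; $i_1(\mathcal{H})$ is the number of $1$-independent sets. The colex order on $\binom{[n]}{r}$ is defined by $A<_C B$ iff $\max(A\mathbin{\triangle}B)\in B$. The colex $r$-graph $\mathcal{C}_r(n,e)$ has vertex set $[n]$ and edge set the first $e$ sets of $\binom{[n]}{r}$ in colex order. -}

module Defs where

open import Data.Bool.Base using (true; false; _xor_)
open import Data.Fin.Base using (Fin; zero; suc) renaming (_≤_ to _≤ᶠ_)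
open import Data.Fin.Subset using (Subset; inside; outside; _∈_; _∩_; ∣_∣)
open import Data.List.Base
  using (List; []; _∷_; length; filter; take; cartesianProductWith)
open import Data.List.Membership.Propositional using () renaming (_∈_ to _∈ˡ_)
open import Data.List.Membership.Propositional.Properties
  using (∈-cartesianProductWith⁺)
open import Data.List.Relation.Binary.Permutation.Propositional
  using (↭-sym; ↭⇒↭ₛ)
open import Data.List.Relation.Binary.Permutation.Propositional.Properties
  using (All-resp-↭)
import Data.List.Relation.Binary.Permutation.Setoid.Properties as PermSetoid
open import Data.List.Relation.Unary.All using (All; []; _∷_; all?)
open import Data.List.Relation.Unary.All.Properties using (all-filter)
  renaming (take⁺ to All-take⁺)
open import Data.List.Relation.Unary.AllPairs using ([]; _∷_)
open import Data.List.Relation.Unary.Any using (here; there)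
open import Data.List.Relation.Unary.Unique.Propositional using (Unique)
open import Data.List.Relation.Unary.Unique.Propositional.Properties
  using (cartesianProductWith⁺; filter⁺) renaming (take⁺ to Unique-take⁺)
import Data.List.Sort as Sort
open import Data.Nat.Base using (ℕ; zero; suc; _<_; z≤n; s≤s)
open import Data.Nat.Properties using (_≟_; _<?_)
open import Data.Product.Base using (_×_; _,_)
open import Data.Sum.Base using (_⊎_; inj₁; inj₂)
open import Data.Vec.Base using ([]; _∷_; zipWith; here; there)
open import Data.Vec.Properties using (∷-injective)
open import Level using (0ℓ)
open import Relation.Binary.Bundles using (StrictTotalOrder; DecTotalOrder)
open import Relation.Binary.Definitions
  using (Transitive; Trichotomous; Tri; tri<; tri≈; tri>)
open import Relation.Binary.PropositionalEquality
  using (_≡_; refl; cong; setoid; isEquivalence)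
import Relation.Binary.Properties.StrictTotalOrder as STO
open import Relation.Binary.Structures.Biased using (isStrictTotalOrderᶜ)
open import Relation.Nullary using (Dec; ¬_; contradiction)

private
  variable
    n r : ℕ

allSubsets : ∀ n → List (Subset n)
allSubsets zero    = [] ∷ []
allSubsets (suc n) =
  cartesianProductWith _∷_ (outside ∷ inside ∷ []) (allSubsets n)

allSubsets-complete : (A : Subset n) → A ∈ˡ allSubsets n
allSubsets-complete []      = here refl
allSubsets-complete (x ∷ A) =
  ∈-cartesianProductWith⁺ _∷_ (side∈ x) (allSubsets-complete A)
  where
  side∈ : ∀ x → x ∈ˡ (outside ∷ inside ∷ [])
  side∈ false = here refl
  side∈ true  = there (here refl)

allSubsets-unique : ∀ n → Unique (allSubsets n)
allSubsets-unique zero    = [] ∷ []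
allSubsets-unique (suc n) =
  cartesianProductWith⁺ _∷_ ∷-injective
    (((λ ()) ∷ []) ∷ [] ∷ []) (allSubsets-unique n)

rSubsets : ∀ r n → List (Subset n)
rSubsets r n = filter (λ A → ∣ A ∣ ≟ r) (allSubsets n)

-- r-graphs on the vertex set Fin n; `unique` rules out repeated edges, so
-- that the length of `edges` is the number of edges.
record RGraph (r n : ℕ) : Set where
  field
    edges   : List (Subset n)
    unique  : Unique edges
    uniform : All (λ E → ∣ E ∣ ≡ r) edges

  numEdges : ℕ
  numEdges = length edges

open RGraph public

Independent : ℕ → RGraph r n → Subset n → Set
Independent j H I = All (λ E → ∣ I ∩ E ∣ < j) (edges H)

independent? : ∀ j (H : RGraph r n) (I : Subset n) → Dec (Independent j H I)
independent? j H I = all? (λ E → ∣ I ∩ E ∣ <? j) (edges H)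

i[_] : ℕ → RGraph r n → ℕ
i[_] {n = n} j H = length (filter (independent? j H) (allSubsets n))

infixr 6 _△_
_△_ : Subset n → Subset n → Subset n
A △ B = zipWith _xor_ A B

IsMax : Fin n → Subset n → Set
IsMax m S = m ∈ S × (∀ x → x ∈ S → x ≤ᶠ m)

-- max (A △ B) ∈ B; false when A ≡ B, as A △ B then has no maximum.
infix 4 _<C_
record _<C_ {n : ℕ} (A B : Subset n) : Set where
  constructor mk<C
  field
    m     : Fin n
    isMax : IsMax m (A △ B)
    m∈B   : m ∈ B

△-self : (A : Subset n) {x : Fin n} → ¬ (x ∈ A △ A)
△-self (true  ∷ A) (there p) = △-self A p
△-self (false ∷ A) (there p) = △-self A p

△-empty⇒≡ : (A B : Subset n) → (∀ x → ¬ (x ∈ A △ B)) → A ≡ B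
△-empty⇒≡ []          []          _ = refl
△-empty⇒≡ (true  ∷ A) (true  ∷ B) h =
  cong (true ∷_) (△-empty⇒≡ A B (λ x p → h (suc x) (there p)))
△-empty⇒≡ (false ∷ A) (false ∷ B) h =
  cong (false ∷_) (△-empty⇒≡ A B (λ x p → h (suc x) (there p)))
△-empty⇒≡ (true  ∷ A) (false ∷ B) h = contradiction here (h zero)
△-empty⇒≡ (false ∷ A) (true  ∷ B) h = contradiction here (h zero)

<C-tail⁺ : ∀ {x y} {A B : Subset n} → A <C B → (x ∷ A) <C (y ∷ B)
<C-tail⁺ (mk<C m (m∈△ , max) m∈B) = mk<C (suc m)
  (there m∈△ , λ where
    zero    _         → z≤n
    (suc x) (there p) → s≤s (max x p))
  (there m∈B)

<C-head⁺ : (A : Subset n) → (outside ∷ A) <C (inside ∷ A)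
<C-head⁺ A = mk<C zero
  (here , λ where
    zero    _         → z≤n
    (suc x) (there p) → contradiction p (△-self A))
  here

<C-∷⁻ : ∀ {x y} {A B : Subset n} → (x ∷ A) <C (y ∷ B) →
        A <C B ⊎ (A ≡ B × x ≡ outside × y ≡ inside)
<C-∷⁻ (mk<C (suc m) (there m∈△ , max) (there m∈B)) =
  inj₁ (mk<C m (m∈△ , λ x p → drop-suc (max (suc x) (there p))) m∈B)
  where
  drop-suc : ∀ {k} {x y : Fin k} → suc x ≤ᶠ suc y → x ≤ᶠ y
  drop-suc (s≤s p) = p
<C-∷⁻ {x = false} {A = A} {B} (mk<C zero (_ , max) here) =
  inj₂ (△-empty⇒≡ A B (λ x p → contradiction (max (suc x) (there p)) λ ())
       , refl , refl)
<C-∷⁻ {x = true} (mk<C zero (() , _) here)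

<C-irrefl : (A : Subset n) → ¬ (A <C A)
<C-irrefl A (mk<C _ (m∈△ , _) _) = △-self A m∈△

<C-trans : Transitive (_<C_ {n})
<C-trans {i = []} {[]} {[]} (mk<C () _ _) _
<C-trans {i = x ∷ A} {y ∷ B} {z ∷ C} p q with <C-∷⁻ p | <C-∷⁻ q
... | inj₁ A<B              | inj₁ B<C              = <C-tail⁺ (<C-trans A<B B<C)
... | inj₁ A<B              | inj₂ (refl , _ , _)   = <C-tail⁺ A<B
... | inj₂ (refl , _ , _)   | inj₁ B<C              = <C-tail⁺ B<C
... | inj₂ (_ , _ , refl)   | inj₂ (_ , () , _)

<C-compare : Trichotomous _≡_ (_<C_ {n})
<C-compare A B = decide (cases A B)
  where
  cases : ∀ {k} (A B : Subset k) → A ≡ B ⊎ A <C B ⊎ B <C A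
  cases []      []      = inj₁ refl
  cases (x ∷ A) (y ∷ B) with cases A B
  ... | inj₂ (inj₁ A<B) = inj₂ (inj₁ (<C-tail⁺ A<B))
  ... | inj₂ (inj₂ B<A) = inj₂ (inj₂ (<C-tail⁺ B<A))
  cases (true  ∷ A) (true  ∷ A) | inj₁ refl = inj₁ refl
  cases (false ∷ A) (false ∷ A) | inj₁ refl = inj₁ refl
  cases (true  ∷ A) (false ∷ A) | inj₁ refl = inj₂ (inj₂ (<C-head⁺ A))
  cases (false ∷ A) (true  ∷ A) | inj₁ refl = inj₂ (inj₁ (<C-head⁺ A))

  decide : A ≡ B ⊎ A <C B ⊎ B <C A → Tri (A <C B) (A ≡ B) (B <C A)
  decide (inj₁ refl)       = tri≈ (<C-irrefl A) refl (<C-irrefl A)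
  decide (inj₂ (inj₁ A<B)) =
    tri< A<B (λ { refl → <C-irrefl A A<B })
         (λ B<A → <C-irrefl A (<C-trans A<B B<A))
  decide (inj₂ (inj₂ B<A)) =
    tri> (λ A<B → <C-irrefl A (<C-trans A<B B<A))
         (λ { refl → <C-irrefl A B<A }) B<A

<C-strictTotalOrder : ℕ → StrictTotalOrder 0ℓ 0ℓ 0ℓ
<C-strictTotalOrder n = record
  { Carrier            = Subset n
  ; _≈_                = _≡_
  ; _<_                = _<C_
  ; isStrictTotalOrder = isStrictTotalOrderᶜ record
    { isEquivalence = isEquivalence
    ; trans         = <C-trans
    ; compare       = <C-compare
    }
  }

colex : ℕ → DecTotalOrder 0ℓ 0ℓ 0ℓ
colex n = STO.decTotalOrder (<C-strictTotalOrder n)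

module ColexSort (n : ℕ) = Sort (colex n)

colexSorted : ∀ r n → List (Subset n)
colexSorted r n = ColexSort.sort n (rSubsets r n)

-- If e exceeds the number of r-subsets, this is the complete r-graph.
colexGraph : ∀ r n → ℕ → RGraph r n
colexGraph r n e = record
  { edges   = take e (colexSorted r n)
  ; unique  = Unique-take⁺ e
      (PermSetoid.Unique-resp-↭ (setoid (Subset n)) (↭⇒↭ₛ (↭-sym sorted↭))
        (filter⁺ (λ A → ∣ A ∣ ≟ r) (allSubsets-unique n)))
  ; uniform = All-take⁺ e
      (All-resp-↭ (↭-sym sorted↭)
        (all-filter (λ A → ∣ A ∣ ≟ r) (allSubsets n)))
  }
  where sorted↭ = ColexSort.sort-↭ n (rSubsets r n)

{-# OPTIONS --safe #-}

-- A set is 1-independent exactly when it lies in the complement of the union U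
-- of all edges, so i₁ is a decreasing function of k = ∣U∣.  The e edges are
-- distinct r-subsets of U, so e is at most the number of r-subsets of [k].
-- These form an initial segment of the colex order, hence every edge of the
-- colex graph is contained in [k].
module Submission where

open import Defs
open import Data.Bool.Base using (true; false)
open import Data.Fin.Base using (zero)
open import Data.Fin.Subset
  using (Subset; inside; outside; _∈_; _∉_; _⊆_; _∩_; _-_; ⋃; ∁; Empty; ∣_∣)
open import Data.Fin.Subset.Properties
  using ( _⊆?_; out⊆; in⊆in; drop-∷-⊆; ⊆-trans; ∣p∣≤n; ∣∁p∣≡n∸∣p∣; ∣⊥∣≡0; ∉⊥
        ; x∈p∩q⁺; x∈p∩q⁻; x∈∁p⇒x∉p; x∉p⇒x∈∁p; p⊆p∪q; q⊆p∪q; x∈p∪q⁻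
        ; Empty-unique; x∈p⇒∣p-x∣<∣p∣ )
open import Data.List.Base using (List; []; _∷_; _++_; length; map; filter; take)
open import Data.List.Membership.Propositional using () renaming (_∈_ to _∈ˡ_)
open import Data.List.Membership.Propositional.Properties
  using (∈-∃++; ∈-filter⁺; ∈-filter⁻)
open import Data.List.Properties
  using (++-identityʳ; filter-++; filter-≐; filter-none; length-++; length-++-sucʳ)
open import Data.List.Relation.Binary.Permutation.Propositional using (↭-sym)
open import Data.List.Relation.Binary.Permutation.Propositional.Properties
  using (∈-resp-↭; shift)
open import Data.List.Relation.Binary.Subset.Propositional
  using () renaming (_⊆_ to _⊆ˡ_)
open import Data.List.Relation.Binary.Subset.Propositional.Properties using (⊆∷∧∉⇒⊆)
open import Data.List.Relation.Unary.All as All using (All; []; _∷_)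
open import Data.List.Relation.Unary.AllPairs using (AllPairs; []; _∷_)
open import Data.List.Relation.Unary.Any using (here; there)
open import Data.List.Relation.Unary.Sorted.TotalOrder.Properties using (Sorted⇒AllPairs)
open import Data.List.Relation.Unary.Unique.Propositional using (Unique)
open import Data.List.Relation.Unary.Unique.Propositional.Properties using (filter⁺)
open import Data.Nat.Base using (ℕ; zero; suc; _+_; _∸_; _≤_; _<_; z≤n; s≤s)
open import Data.Nat.Properties
  using (≤-trans; ≤-reflexive; n≮0; n<1⇒n≡0; +-identityʳ; module ≤-Reasoning; _≟_)
open import Data.Product.Base using (_×_; _,_; proj₁; proj₂; map₁)
open import Data.Sum.Base using (_⊎_; inj₁; inj₂)
open import Data.Unit.Base using (tt)
open import Data.Vec.Base using ([]; _∷_; here; there)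
open import Function.Base using (_∘_; case_of_)
open import Level using (Level)
open import Relation.Binary.Bundles using (DecTotalOrder)
open import Relation.Binary.PropositionalEquality
  using (_≡_; refl; sym; trans; cong; cong₂; subst; module ≡-Reasoning)
open import Relation.Nullary using (¬_; does; yes; no; contradiction)
open import Relation.Nullary.Decidable using (_×-dec_)
open import Relation.Unary using (Pred; Decidable)
open import Relation.Unary.Properties using (U?)

private
  variable
    a b p ℓ : Level
    n r k : ℕ

-- Counting in duplicate-free and sorted lists

-- Pigeonhole, by induction on `xs`: one occurrence of the head is cut out of `ys`, and the tail,
-- which avoids the head, still embeds in what remains.
Unique∧⊆⇒length≤ : {A : Set a} {xs ys : List A} →
                   Unique xs → xs ⊆ˡ ys → length xs ≤ length ys
Unique∧⊆⇒length≤ []             _     = z≤n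
Unique∧⊆⇒length≤ {xs = x ∷ xs} (x∉xs ∷ xs!) xs⊆ys
  with as , bs , refl ← ∈-∃++ (xs⊆ys (here refl)) = begin
  suc (length xs)          ≤⟨ s≤s (Unique∧⊆⇒length≤ xs! xs⊆as++bs) ⟩
  suc (length (as ++ bs))  ≡⟨ length-++-sucʳ as x bs ⟨
  length (as ++ x ∷ bs)    ∎
  where
  open ≤-Reasoning
  xs⊆as++bs : xs ⊆ˡ as ++ bs
  xs⊆as++bs = ⊆∷∧∉⇒⊆ (∈-resp-↭ (shift x as bs) ∘ xs⊆ys ∘ there)
                     (λ x∈xs → All.lookup x∉xs x∈xs refl)

module _ {A : Set a} {P : Pred A p} (P? : Decidable P) where

  length-filter-map : {B : Set b} (f : B → A) (xs : List B) →
                      length (filter P? (map f xs)) ≡ length (filter (P? ∘ f) xs)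
  length-filter-map f []       = refl
  length-filter-map f (x ∷ xs) with does (P? (f x))
  ... | false = length-filter-map f xs
  ... | true  = cong suc (length-filter-map f xs)

  -- In a sorted list the elements satisfying a down-closed property form a prefix, so once there
  -- are at least `e` of them they fill the first `e` places.
  All-take-downClosed : {_≼_ : A → A → Set ℓ} → (∀ {x y} → x ≼ y → P y → P x) →
                        ∀ {xs} → AllPairs _≼_ xs →
                        ∀ {e} → e ≤ length (filter P? xs) → All P (take e xs)
  All-take-downClosed down xs↗ {zero} _ = []
  All-take-downClosed down {x ∷ xs} (x≼xs ∷ xs↗) {suc e} e< with P? x
  ... | yes Px = Px ∷ All-take-downClosed down xs↗ (case e< of λ { (s≤s e≤) → e≤ })
  -- If the head fails, every later element fails as well, so the filtered list is empty and cannot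
  -- have length at least `suc e`.
  ... | no ¬Px = contradiction
    (subst (suc e ≤_)
           (cong length (filter-none P? (All.map (λ x≼y Py → ¬Px (down x≼y Py)) x≼xs)))
           e<)
    n≮0

-- Counting the subsets of a fixed set

count : {P : Pred (Subset n) p} → Decidable P → ℕ
count {n = n} P? = length (filter P? (allSubsets n))

count-cong : {P : Pred (Subset n) p} {Q : Pred (Subset n) ℓ}
             (P? : Decidable P) (Q? : Decidable Q) →
             (∀ {A} → P A → Q A) → (∀ {A} → Q A → P A) → count P? ≡ count Q?
count-cong {n = n} P? Q? P⇒Q Q⇒P =
  cong length (filter-≐ P? Q? (P⇒Q , Q⇒P) (allSubsets n))

count-mono : {P : Pred (Subset n) p} {Q : Pred (Subset n) ℓ}
             (P? : Decidable P) (Q? : Decidable Q) →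
             (∀ {A} → P A → Q A) → count P? ≤ count Q?
count-mono {n = n} P? Q? P⇒Q =
  Unique∧⊆⇒length≤ (filter⁺ P? (allSubsets-unique n)) λ A∈ →
    ∈-filter⁺ Q? (allSubsets-complete _) (P⇒Q (proj₂ (∈-filter⁻ P? {xs = allSubsets n} A∈)))

count-none : {P : Pred (Subset n) p} (P? : Decidable P) → (∀ A → ¬ P A) → count P? ≡ 0
count-none {n = n} P? ¬P =
  cong length (filter-none P? {xs = allSubsets n} (All.universal ¬P _))

count-∷ : {P : Pred (Subset (suc n)) p} (P? : Decidable P) →
          count P? ≡ count (P? ∘ (outside ∷_)) + count (P? ∘ (inside ∷_))
count-∷ {n = n} P? = begin
  length (filter P? (outs ++ ins ++ []))
    ≡⟨ cong (λ xs → length (filter P? (outs ++ xs))) (++-identityʳ ins) ⟩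
  length (filter P? (outs ++ ins))
    ≡⟨ cong length (filter-++ P? outs ins) ⟩
  length (filter P? outs ++ filter P? ins)
    ≡⟨ length-++ (filter P? outs) ⟩
  length (filter P? outs) + length (filter P? ins)
    ≡⟨ cong₂ _+_ (length-filter-map P? (outside ∷_) (allSubsets n))
                 (length-filter-map P? (inside  ∷_) (allSubsets n)) ⟩
  count (P? ∘ (outside ∷_)) + count (P? ∘ (inside ∷_)) ∎
  where
  open ≡-Reasoning
  outs ins : List (Subset (suc n))
  outs = map (outside ∷_) (allSubsets n)
  ins  = map (inside  ∷_) (allSubsets n)

-- The size condition is left as a parameter: equality with `r` counts the possible edges inside
-- `W`, and the trivial predicate counts all subsets of `W`.
within? : {Q : Pred ℕ p} → Decidable Q → (W : Subset n) →
          Decidable (λ A → A ⊆ W × Q ∣ A ∣)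
within? Q? W A = (A ⊆? W) ×-dec Q? ∣ A ∣

-- Positions outside `W` are forced, so deleting them is a size-preserving bijection onto the
-- subsets of a set with `∣ W ∣` elements. The induction needs all `Q` at once, because a head
-- chosen inside turns the condition on the tail into `Q ∘ suc`.
count-within : {Q : Pred ℕ p} (Q? : Decidable Q) (W : Subset n) →
               count (within? Q? W) ≡ count {n = ∣ W ∣} (Q? ∘ ∣_∣)
count-within Q? [] =
  count-cong (within? Q? []) (Q? ∘ ∣_∣) proj₂ λ {A} q → (λ { {()} }) , q
count-within {Q = Q} Q? (outside ∷ W) = begin
  count (within? Q? (outside ∷ W))
    ≡⟨ count-∷ (within? Q? (outside ∷ W)) ⟩
  count (within? Q? (outside ∷ W) ∘ (outside ∷_)) +
  count (within? Q? (outside ∷ W) ∘ (inside ∷_))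
    ≡⟨ cong₂ _+_
         (count-cong (within? Q? (outside ∷ W) ∘ (outside ∷_)) (within? Q? W)
           (map₁ λ A⊆ → drop-∷-⊆ A⊆) (map₁ λ A⊆ → out⊆ A⊆))
         (count-none (within? Q? (outside ∷ W) ∘ (inside ∷_))
           λ _ (in⊆out , _) → case in⊆out {zero} here of λ ()) ⟩
  count (within? Q? W) + 0
    ≡⟨ +-identityʳ _ ⟩
  count (within? Q? W)
    ≡⟨ count-within Q? W ⟩
  count {n = ∣ W ∣} (Q? ∘ ∣_∣) ∎
  where open ≡-Reasoning
count-within Q? (inside ∷ W) = begin
  count (within? Q? (inside ∷ W))
    ≡⟨ count-∷ (within? Q? (inside ∷ W)) ⟩
  count (within? Q? (inside ∷ W) ∘ (outside ∷_)) +
  count (within? Q? (inside ∷ W) ∘ (inside ∷_))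
    ≡⟨ cong₂ _+_
         (count-cong (within? Q? (inside ∷ W) ∘ (outside ∷_)) (within? Q? W)
           (map₁ λ A⊆ → drop-∷-⊆ A⊆) (map₁ λ A⊆ → out⊆ A⊆))
         (count-cong (within? Q? (inside ∷ W) ∘ (inside ∷_)) (within? (Q? ∘ suc) W)
           (map₁ λ A⊆ → drop-∷-⊆ A⊆) (map₁ λ A⊆ → in⊆in A⊆)) ⟩
  count (within? Q? W) + count (within? (Q? ∘ suc) W)
    ≡⟨ cong₂ _+_ (count-within Q? W) (count-within (Q? ∘ suc) W) ⟩
  count {n = ∣ W ∣} (Q? ∘ ∣_∣) + count {n = ∣ W ∣} (Q? ∘ suc ∘ ∣_∣)
    ≡⟨ count-∷ {n = ∣ W ∣} (Q? ∘ ∣_∣) ⟨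
  count {n = suc ∣ W ∣} (Q? ∘ ∣_∣) ∎
  where open ≡-Reasoning

count-within-≡ : {Q : Pred ℕ p} (Q? : Decidable Q) (V W : Subset n) →
                 ∣ V ∣ ≡ ∣ W ∣ → count (within? Q? V) ≡ count (within? Q? W)
count-within-≡ Q? V W ∣V∣≡∣W∣ = begin
  count (within? Q? V)          ≡⟨ count-within Q? V ⟩
  count {n = ∣ V ∣} (Q? ∘ ∣_∣)  ≡⟨ cong (λ k → count {n = k} (Q? ∘ ∣_∣)) ∣V∣≡∣W∣ ⟩
  count {n = ∣ W ∣} (Q? ∘ ∣_∣)  ≡⟨ count-within Q? W ⟨
  count (within? Q? W)          ∎
  where open ≡-Reasoning

-- Initial segments and the colex order

segment : ∀ n → ℕ → Subset n
segment zero    _       = []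
segment (suc n) zero    = outside ∷ segment n zero
segment (suc n) (suc k) = inside ∷ segment n k

∣segment∣ : k ≤ n → ∣ segment n k ∣ ≡ k
∣segment∣ {n = zero}  z≤n       = refl
∣segment∣ {n = suc n} z≤n       = ∣segment∣ {n = n} z≤n
∣segment∣             (s≤s k≤n) = cong suc (∣segment∣ k≤n)

∉segment-zero : ∀ n {x} → x ∉ segment n 0
∉segment-zero (suc n) (there x∈) = ∉segment-zero n x∈

-- The largest element of `A △ B` lies in `B`, hence in the segment, and above it `A` and `B` agree,
-- so `A` cannot leave the segment. The induction strips vertex 0 from both sets by `<C-∷⁻`.
segment-downClosed : ∀ k {A B : Subset n} → A <C B → B ⊆ segment n k → A ⊆ segment n k
segment-downClosed {n} zero (mk<C m _ m∈B) B⊆ = contradiction (B⊆ m∈B) (∉segment-zero n)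
segment-downClosed (suc k) {_ ∷ A} {_ ∷ B} A<B B⊆ = ∷⊆inside (tail (<C-∷⁻ A<B))
  where
  tail : A <C B ⊎ (A ≡ B × _) → A ⊆ segment _ k
  tail (inj₁ A<B)        = segment-downClosed k A<B (drop-∷-⊆ B⊆)
  tail (inj₂ (refl , _)) = drop-∷-⊆ B⊆
  ∷⊆inside : ∀ {m x} {A B : Subset m} → A ⊆ B → (x ∷ A) ⊆ (inside ∷ B)
  ∷⊆inside A⊆B here       = here
  ∷⊆inside A⊆B (there x∈) = there (A⊆B x∈)

-- Unions of edges and 1-independence

∈⇒⊆⋃ : ∀ {E : Subset n} {Es} → E ∈ˡ Es → E ⊆ ⋃ Es
∈⇒⊆⋃ {Es = _ ∷ Es} (here refl)  = p⊆p∪q (⋃ Es)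
∈⇒⊆⋃ {Es = F ∷ Es} (there E∈Es) = ⊆-trans (∈⇒⊆⋃ E∈Es) (q⊆p∪q F (⋃ Es))

∣p∣<1⇒Empty : {p : Subset n} → ∣ p ∣ < 1 → Empty p
∣p∣<1⇒Empty {p = p} ∣p∣<1 (x , x∈p) =
  -- Deleting `x` from a set of size 0 would leave a set of size below 0.
  n≮0 (subst (∣ p - x ∣ <_) (n<1⇒n≡0 ∣p∣<1) (x∈p⇒∣p-x∣<∣p∣ x∈p))

Empty⇒∣p∣<1 : {p : Subset n} → Empty p → ∣ p ∣ < 1
Empty⇒∣p∣<1 {n = n} ∅p with refl ← Empty-unique ∅p = s≤s (≤-reflexive (∣⊥∣≡0 n))

disjoint⇒⊆∁⋃ : {I : Subset n} (Es : List (Subset n)) →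
               All (λ E → ∣ I ∩ E ∣ < 1) Es → I ⊆ ∁ (⋃ Es)
disjoint⇒⊆∁⋃ {I = I} Es I∩Es x∈I = x∉p⇒x∈∁p (x∉⋃ Es I∩Es)
  where
  x∉⋃ : ∀ Es → All (λ E → ∣ I ∩ E ∣ < 1) Es → _ ∉ ⋃ Es
  x∉⋃ []       []             x∈ = ∉⊥ x∈
  x∉⋃ (E ∷ Es) (I∩E ∷ I∩Es) x∈ with x∈p∪q⁻ E (⋃ Es) x∈
  ... | inj₁ x∈E = ∣p∣<1⇒Empty I∩E (_ , x∈p∩q⁺ (x∈I , x∈E))
  ... | inj₂ x∈⋃ = x∉⋃ Es I∩Es x∈⋃

⊆∁⇒disjoint : {I E W : Subset n} → E ⊆ W → I ⊆ ∁ W → ∣ I ∩ E ∣ < 1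
⊆∁⇒disjoint {I = I} {E} E⊆W I⊆∁W = Empty⇒∣p∣<1 λ (x , x∈I∩E) →
  case x∈p∩q⁻ I E x∈I∩E of λ (x∈I , x∈E) → x∈∁p⇒x∉p (I⊆∁W x∈I) (E⊆W x∈E)

-- Comparison with the colex graph

-- At least `e` of the sorted `r`-subsets lie in the segment, and lying in it passes down the colex
-- order, so the first `e` of them do.
colexEdges⊆segment : ∀ r n k {e} → e ≤ count (within? (_≟ r) (segment n k)) →
                     All (_⊆ segment n k) (edges (colexGraph r n e))
colexEdges⊆segment r n k e≤ =
  All-take-downClosed (_⊆? segment n k) down
    (Sorted⇒AllPairs (DecTotalOrder.totalOrder (colex n)) (ColexSort.sort-↗ n (rSubsets r n)))
    (≤-trans e≤ (Unique∧⊆⇒length≤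
      (filter⁺ (within? (_≟ r) (segment n k)) (allSubsets-unique n)) sub))
  where
  down : ∀ {A B} → A <C B ⊎ A ≡ B → B ⊆ segment n k → A ⊆ segment n k
  down (inj₁ A<B)  = segment-downClosed k A<B
  down (inj₂ refl) = λ B⊆ → B⊆
  sub : filter (within? (_≟ r) (segment n k)) (allSubsets n) ⊆ˡ
        filter (_⊆? segment n k) (colexSorted r n)
  sub A∈ with A∈all , A⊆ , ∣A∣≡r ← ∈-filter⁻ (within? (_≟ r) (segment n k)) {xs = allSubsets n} A∈ =
    ∈-filter⁺ (_⊆? segment n k)
      (∈-resp-↭ (↭-sym (ColexSort.sort-↭ n (rSubsets r n)))
        (∈-filter⁺ (λ A → ∣ A ∣ ≟ r) A∈all ∣A∣≡r))
      A⊆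

theorem3 : ∀ (r n e : ℕ) → 1 ≤ r → (H : RGraph r n) → numEdges H ≡ e →
    i[ 1 ] H ≤ i[ 1 ] (colexGraph r n e)
theorem3 r n e _ H refl = begin
  count (independent? 1 H)
    ≤⟨ count-mono (independent? 1 H) (within? U? (∁ V))
         (λ ind → disjoint⇒⊆∁⋃ (edges H) ind , tt) ⟩
  count (within? U? (∁ V))
    ≡⟨ count-within-≡ U? (∁ V) (∁ W) ∣∁V∣≡∣∁W∣ ⟩
  count (within? U? (∁ W))
    -- The colex edges lie in `W` but may fail to cover it, so a set missing `W` is independent
    -- while the converse can fail.
    ≤⟨ count-mono (within? U? (∁ W)) (independent? 1 C)
         (λ (I⊆∁W , _) → All.map {P = _⊆ W} (λ E⊆W → ⊆∁⇒disjoint E⊆W I⊆∁W)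
                                 (colexEdges⊆segment r n ∣ V ∣ e≤)) ⟩
  count (independent? 1 C) ∎
  where
  open ≤-Reasoning
  V W : Subset n
  V = ⋃ (edges H)
  W = segment n ∣ V ∣
  C : RGraph r n
  C = colexGraph r n e
  ∣V∣≡∣W∣ : ∣ V ∣ ≡ ∣ W ∣
  -- A segment has its nominal size only up to `n`, hence the bound on `∣ V ∣`.
  ∣V∣≡∣W∣ = sym (∣segment∣ (∣p∣≤n V))
  ∣∁V∣≡∣∁W∣ : ∣ ∁ V ∣ ≡ ∣ ∁ W ∣
  ∣∁V∣≡∣∁W∣ = trans (∣∁p∣≡n∸∣p∣ V) (trans (cong (n ∸_) ∣V∣≡∣W∣) (sym (∣∁p∣≡n∸∣p∣ W)))
  e≤ : numEdges H ≤ count (within? (_≟ r) W)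
  e≤ = begin
    numEdges H
      -- The edges of `H` are distinct `r`-subsets of their union `V`, so the pigeonhole bound
      -- applies.
      ≤⟨ Unique∧⊆⇒length≤ (unique H) (λ E∈H →
           ∈-filter⁺ (within? (_≟ r) V) (allSubsets-complete _)
             (∈⇒⊆⋃ E∈H , All.lookup (uniform H) E∈H)) ⟩
    count (within? (_≟ r) V)
      ≡⟨ count-within-≡ (_≟ r) V W ∣V∣≡∣W∣ ⟩
    count (within? (_≟ r) W) ∎
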